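{- Let $\tau\ge1$ be an integer, $S_0>0$, $\mathcal U=[-\underline{\zeta},\overline{\zeta}]$ with $\underline{\zeta},\overline{\zeta}>0$, and let $g:\mathbb R\to\mathbb R$ be convex. Then the price upper bound $A_0(S_0)$ of the $\tau$-round American option hedging game with payoff $g$ and uncertainty set $\mathcal U$ in every round equals the price upper bound $E_0(S_0)$ of its European counterpart. That is, it is optimal to exercise at maturity: for every $t<\tau$ and every $x$ the continuation value satisfies $\min_{\Delta}\max_{R\in\mathcal U}[A_{t+1}(x(1+R))-R\Delta]\ge g(x)$.
   Context: European upper bound: $E_\tau(x)=g(x)$ and, for $t=\tau-1,\dots,0$, $$E_t(x)=\min_{\Delta\in\mathbb R}\max_{R\in\mathcal U}\bigl[E_{t+1}(x(1+R))-R\Delta\bigr].$$ American upper bound (the adversary, as holder of the option, may exercise at the beginning of any round and receive $g$ of the current price): $A_\tau(x)=g(x)$ and, for $t=\tau-1,\dots,0$, $$A_t(x)=\max\Bigl\{\min_{\Delta\in\mathbb R}\max_{R\in\mathcal U}\bigl[A_{t+1}(x(1+R))-R\Delta\bigr],\ g(x)\Bigr\}.$$ The price upper bounds with initial price $S_0$ are $E_0(S_0)$ and $A_0(S_0)$. -}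

module Defs where

open import Algebra.Bundles using (CommutativeRing)
open import Data.Nat using (ℕ; suc) renaming (_<_ to _<ᴺ_)
open import Data.Product using (∃; ∃-syntax; _×_)
open import Level using (Level; _⊔_) renaming (suc to lsuc)
open import Relation.Binary.Bundles using (TotalOrder)
open import Relation.Binary.Core using (Rel)
open import Relation.Binary.Structures using (IsTotalOrder)
open import Relation.Nullary using (¬_)
open import Relation.Unary using (Pred; Satisfiable; U)
import Algebra.Construct.NaturalChoice.Max as Max
import Relation.Binary.Construct.NonStrictToStrict as ToStrict

-- The classical axioms of the real numbers (unique up to isomorphism): a
-- totally ordered field in which every nonempty set that is bounded above
-- has a least upper bound.
record RealNumbers (c ℓ₁ ℓ₂ : Level) : Set (lsuc (c ⊔ ℓ₁ ⊔ ℓ₂)) where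
  infix 4 _≤_
  field
    commutativeRing : CommutativeRing c ℓ₁

  open CommutativeRing commutativeRing public

  field
    _≤_          : Rel Carrier ℓ₂
    isTotalOrder : IsTotalOrder _≈_ _≤_
    0≉1          : ¬ (0# ≈ 1#)
    inverse      : ∀ x → ¬ (x ≈ 0#) → ∃[ y ] (x * y ≈ 1#)
    +-monoˡ-≤    : ∀ z {x y} → x ≤ y → x + z ≤ y + z
    *-nonneg     : ∀ {x y} → 0# ≤ x → 0# ≤ y → 0# ≤ x * y

  UpperBound : ∀ {ℓ} → Pred Carrier ℓ → Carrier → Set (c ⊔ ℓ₂ ⊔ ℓ)
  UpperBound P b = ∀ x → P x → x ≤ b

  field
    complete : (P : Pred Carrier (c ⊔ ℓ₁ ⊔ ℓ₂)) →
               Satisfiable P → ∃ (UpperBound P) →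
               ∃[ s ] (UpperBound P s × (∀ b → UpperBound P b → s ≤ b))

  totalOrder : TotalOrder c ℓ₁ ℓ₂
  totalOrder = record { isTotalOrder = isTotalOrder }

  open ToStrict _≈_ _≤_ public using (_<_)

  open Max totalOrder public using () renaming (_⊔_ to max)

module HedgingGame {c ℓ₁ ℓ₂ : Level} (ℝ : RealNumbers c ℓ₁ ℓ₂) where
  open RealNumbers ℝ

  Convex : (Carrier → Carrier) → Set (c ⊔ ℓ₂)
  Convex g = ∀ x y θ → 0# ≤ θ → θ ≤ 1# →
             g (θ * x + (1# - θ) * y) ≤ θ * g x + (1# - θ) * g y

  Interval : Carrier → Carrier → Pred Carrier ℓ₂
  Interval a b x = a ≤ x × x ≤ b

  -- `IsMax S f v` reads "max_{s ∈ S} f s exists and equals v"; in particular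
  -- the maximum is attained. Likewise for `IsMin`.
  IsMax IsMin : ∀ {ℓ} → Pred Carrier ℓ → (Carrier → Carrier) → Carrier →
                Set (c ⊔ ℓ₁ ⊔ ℓ₂ ⊔ ℓ)
  IsMax S f v = (∃[ s ] (S s × f s ≈ v)) × (∀ s → S s → f s ≤ v)
  IsMin S f v = (∃[ s ] (S s × f s ≈ v)) × (∀ s → S s → v ≤ f s)

  module _ (𝒰 : Pred Carrier ℓ₂) where

    -- v = min_{Δ ∈ ℝ} max_{R ∈ 𝒰} [ V (x (1 + R)) - R Δ ]; here m Δ is the
    -- value of the inner maximum.
    IsContinuationValue : (V : Carrier → Carrier) (x v : Carrier) →
                          Set (c ⊔ ℓ₁ ⊔ ℓ₂)
    IsContinuationValue V x v =
      ∃[ m ] ((∀ Δ → IsMax 𝒰 (λ R → V (x * (1# + R)) - R * Δ) (m Δ))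
              × IsMin U m v)

    -- The value functions are indexed by all of ℕ, but only the rounds
    -- 0, …, τ are constrained.
    IsEuropeanValue IsAmericanValue :
      (τ : ℕ) (g : Carrier → Carrier) (V : ℕ → Carrier → Carrier) →
      Set (c ⊔ ℓ₁ ⊔ ℓ₂)
    IsEuropeanValue τ g E =
        (∀ x → E τ x ≈ g x)
      × (∀ t → t <ᴺ τ → ∀ x → IsContinuationValue (E (suc t)) x (E t x))
    IsAmericanValue τ g A =
        (∀ x → A τ x ≈ g x)
      × (∀ t → t <ᴺ τ → ∀ x →
           ∃[ v ] (IsContinuationValue (A (suc t)) x v × A t x ≈ max v (g x)))

{-# OPTIONS --safe #-}
module Submission where

-- The inner objective is convex in R, so its maximum sits at an end of 𝒰 = [l, u].
-- With p l + q u = 0 (p, q ≥ 0, p + q = 1), the weighted average of the two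
-- endpoint values does not depend on Δ, and some Δ equalises them; hence the
-- continuation value is p V(x(1 + l)) + q V(x(1 + u)). This operator preserves
-- convexity, and by Jensen it sends a V above g to a function above g, so the
-- maximum in the American recursion is always the continuation value.

open import Defs
open import Data.Nat using (ℕ; zero; suc; _∸_; z<s) renaming (_≤_ to _≤ᴺ_; _<_ to _<ᴺ_; _+_ to _+ᴺ_)
open import Data.Nat.Properties using (+-∸-assoc; +-suc; m<n+m; m∸n+n≡m; n∸n≡0)
  renaming (+-identityʳ to +-identityʳᴺ)
open import Data.Product using (∃-syntax; _×_; _,_; proj₁; proj₂)
open import Data.Sum using (inj₁; inj₂)
open import Data.Unit using (tt)
open import Function.Definitions using (Congruent)
open import Level using (Level; _⊔_)
open import Relation.Binary.Bundles using (TotalOrder)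
open import Relation.Nullary using (¬_)
import Relation.Binary.PropositionalEquality as ≡
import Algebra.Construct.NaturalChoice.Max as Max
import Algebra.Properties.Ring as RingProperties
import Algebra.Solver.Ring.NaturalCoefficients.Default as SemiringSolver
import Relation.Binary.Reasoning.PartialOrder as PartialOrderReasoning
import Relation.Binary.Reasoning.Setoid as SetoidReasoning

module _ {c ℓ₁ ℓ₂ : Level} (ℝ : RealNumbers c ℓ₁ ℓ₂) where
  open RealNumbers ℝ
  open HedgingGame ℝ
  open TotalOrder totalOrder using (poset; antisym; total; ≤-respˡ-≈; ≤-respʳ-≈)
    renaming (refl to ≤-refl; trans to ≤-trans; reflexive to ≤-reflexive)
  open Max totalOrder using (⊔-sel; ⊔-idem; ⊔-cong; x≤x⊔y; x≤y⊔x; x≤y⇒y⊔x≈y)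
  open RingProperties ring using (-‿distribʳ-*; -‿involutive)
  open SemiringSolver commutativeSemiring using (solve; _:+_; _:*_; _:=_; con)
  module ≤-Reasoning = PartialOrderReasoning poset
  module ≈-Reasoning = SetoidReasoning setoid

  -- The semiring solver sees `- y` as a variable `y⁻` unrelated to `y`. Its identities therefore
  -- gather whatever depends on `y - y` being zero into summands `e * (y - y)`, which this lemma
  -- adds or removes.
  cancel : ∀ z e y → z + e * (y - y) ≈ z
  cancel z e y = begin
    z + e * (y - y) ≈⟨ +-congˡ (*-congˡ (-‿inverseʳ y)) ⟩
    z + e * 0#      ≈⟨ +-congˡ (zeroʳ e) ⟩
    z + 0#          ≈⟨ +-identityʳ z ⟩
    z               ∎
    where open ≈-Reasoning

  -- Inequalities in an ordered field.

  +-mono-≤ : ∀ {x y z w} → x ≤ y → z ≤ w → x + z ≤ y + w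
  +-mono-≤ {x} {y} {z} {w} x≤y z≤w = begin
    x + z ≤⟨ +-monoˡ-≤ z x≤y ⟩
    y + z ≈⟨ +-comm y z ⟩
    z + y ≤⟨ +-monoˡ-≤ y z≤w ⟩
    w + y ≈⟨ +-comm w y ⟩
    y + w ∎
    where open ≤-Reasoning

  x≤y⇒0≤y-x : ∀ {x y} → x ≤ y → 0# ≤ y - x
  x≤y⇒0≤y-x {x} x≤y = ≤-respˡ-≈ (-‿inverseʳ x) (+-monoˡ-≤ (- x) x≤y)

  0≤⇒-≤0 : ∀ {x} → 0# ≤ x → - x ≤ 0#
  0≤⇒-≤0 {x} 0≤x = begin
    - x      ≈⟨ +-identityˡ (- x) ⟨
    0# - x   ≤⟨ +-monoˡ-≤ (- x) 0≤x ⟩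
    x - x    ≈⟨ -‿inverseʳ x ⟩
    0#       ∎
    where open ≤-Reasoning

  *-monoʳ-≤ : ∀ {p x y} → 0# ≤ p → x ≤ y → p * x ≤ p * y
  *-monoʳ-≤ {p} {x} {y} 0≤p x≤y = begin
    p * x                 ≈⟨ +-identityˡ (p * x) ⟨
    0# + p * x            ≤⟨ +-monoˡ-≤ (p * x) (*-nonneg 0≤p (x≤y⇒0≤y-x x≤y)) ⟩
    p * (y - x) + p * x   ≈⟨ solve 4 (λ p x y x⁻ → p :* (y :+ x⁻) :+ p :* x := p :* y :+ p :* (x :+ x⁻)) refl p x y (- x) ⟩
    p * y + p * (x - x)   ≈⟨ cancel (p * y) p x ⟩
    p * y                 ∎
    where open ≤-Reasoning

  0≤x*x : ∀ x → 0# ≤ x * x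
  0≤x*x x with total 0# x
  ... | inj₁ 0≤x = *-nonneg 0≤x 0≤x
  ... | inj₂ x≤0 = ≤-respʳ-≈ -x*-x≈x*x (*-nonneg 0≤-x 0≤-x)
    where
    0≤-x : 0# ≤ - x
    0≤-x = ≤-respʳ-≈ (+-identityˡ (- x)) (x≤y⇒0≤y-x x≤0)
    -x*-x≈x*x : - x * - x ≈ x * x
    -x*-x≈x*x = begin
      - x * - x                     ≈⟨ cancel (- x * - x) x x ⟨
      - x * - x + x * (x - x)       ≈⟨ solve 2 (λ x x⁻ → x⁻ :* x⁻ :+ x :* (x :+ x⁻) := x :* x :+ x⁻ :* (x :+ x⁻)) refl x (- x) ⟩
      x * x + - x * (x - x)         ≈⟨ cancel (x * x) (- x) x ⟩
      x * x                         ∎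
      where open ≈-Reasoning

  -- `y` equals `x * (y * y)`, a product of nonnegative factors.
  inverse-nonneg : ∀ {x y} → 0# ≤ x → x * y ≈ 1# → 0# ≤ y
  inverse-nonneg {x} {y} 0≤x xy≈1 = ≤-respʳ-≈ x[yy]≈y (*-nonneg 0≤x (0≤x*x y))
    where
    x[yy]≈y : x * (y * y) ≈ y
    x[yy]≈y = trans (sym (*-assoc x y y)) (trans (*-congʳ xy≈1) (*-identityˡ y))

  IsMax-cong : ∀ {ℓ} {S : Carrier → Set ℓ} {f h v} →
               (∀ s → f s ≈ h s) → IsMax S f v → IsMax S h v
  IsMax-cong f≈h ((s , s∈S , fs≈v) , f≤v) =
    (s , s∈S , trans (sym (f≈h s)) fs≈v) , λ r r∈S → ≤-respˡ-≈ (f≈h r) (f≤v r r∈S)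

  -- Weighted averages and Jensen's inequality.

  record Weights (p q : Carrier) : Set (ℓ₁ ⊔ ℓ₂) where
    field
      0≤p   : 0# ≤ p
      0≤q   : 0# ≤ q
      p+q≈1 : p + q ≈ 1#

  average-const : ∀ {p q} → p + q ≈ 1# → ∀ v → p * v + q * v ≈ v
  average-const {p} {q} p+q≈1 v =
    trans (sym (distribʳ v p q)) (trans (*-congʳ p+q≈1) (*-identityˡ v))

  average-mono : ∀ {p q x x′ y y′} → Weights p q → x ≤ x′ → y ≤ y′ →
                 p * x + q * y ≤ p * x′ + q * y′
  average-mono w x≤x′ y≤y′ = +-mono-≤ (*-monoʳ-≤ 0≤p x≤x′) (*-monoʳ-≤ 0≤q y≤y′)
    where open Weights w

  average≤max : ∀ {p q} → Weights p q → ∀ x y → p * x + q * y ≤ max x y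
  average≤max w x y =
    ≤-respʳ-≈ (average-const (Weights.p+q≈1 w) _) (average-mono w (x≤x⊔y x y) (x≤y⊔x x y))

  -- Convexity in the symmetric form with two weights, which is subtraction-free.
  Jensen : (Carrier → Carrier) → Set (c ⊔ ℓ₁ ⊔ ℓ₂)
  Jensen f = ∀ {p q} → Weights p q → ∀ x y → f (p * x + q * y) ≤ p * f x + q * f y

  convex⇒Jensen : ∀ {f} → Congruent _≈_ _≈_ f → Convex f → Jensen f
  convex⇒Jensen {f} f-cong convex {p} {q} w x y = begin
    f (p * x + q * y)              ≈⟨ f-cong (+-congˡ (*-congʳ 1-p≈q)) ⟨
    f (p * x + (1# - p) * y)       ≤⟨ convex x y p 0≤p p≤1 ⟩
    p * f x + (1# - p) * f y       ≈⟨ +-congˡ (*-congʳ 1-p≈q) ⟩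
    p * f x + q * f y              ∎
    where
    open ≤-Reasoning
    open Weights w
    p≤1 : p ≤ 1#
    p≤1 = begin
      p       ≈⟨ +-identityʳ p ⟨
      p + 0#  ≤⟨ +-mono-≤ ≤-refl 0≤q ⟩
      p + q   ≈⟨ p+q≈1 ⟩
      1#      ∎
    1-p≈q : 1# - p ≈ q
    1-p≈q = begin-equality
      1# - p             ≈⟨ +-congʳ p+q≈1 ⟨
      p + q - p          ≈⟨ solve 3 (λ p q p⁻ → p :+ q :+ p⁻ := q :+ con 1 :* (p :+ p⁻)) refl p q (- p) ⟩
      q + 1# * (p - p)   ≈⟨ cancel q 1# p ⟩
      q                  ∎

  -- The next price is affine in the return; writing 1 as `p + q` makes this a semiring identity. It
  -- transports Jensen's inequality from prices to returns.
  returns-average : ∀ {p q} → p + q ≈ 1# → ∀ x R S →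
                    x * (1# + (p * R + q * S)) ≈ p * (x * (1# + R)) + q * (x * (1# + S))
  returns-average {p} {q} p+q≈1 x R S = begin
    x * (1# + (p * R + q * S))               ≈⟨ *-congˡ (+-congʳ p+q≈1) ⟨
    x * ((p + q) + (p * R + q * S))          ≈⟨ solve 5 (λ p q x R S →
        x :* ((p :+ q) :+ (p :* R :+ q :* S)) :=
        p :* (x :* (con 1 :+ R)) :+ q :* (x :* (con 1 :+ S))) refl p q x R S ⟩
    p * (x * (1# + R)) + q * (x * (1# + S))  ∎
    where open ≈-Reasoning

  -- Convexity of the inner objective.

  objective : (Carrier → Carrier) → (x Δ R : Carrier) → Carrier
  objective V x Δ R = V (x * (1# + R)) - R * Δ

  module _ {V : Carrier → Carrier} (V-cong : Congruent _≈_ _≈_ V) where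

    objective-cong : ∀ x Δ → Congruent _≈_ _≈_ (objective V x Δ)
    objective-cong x Δ R≈S = +-cong (V-cong (*-congˡ (+-congˡ R≈S))) (-‿cong (*-congʳ R≈S))

    objective-Jensen : Jensen V → ∀ x Δ → Jensen (objective V x Δ)
    objective-Jensen jensen x Δ {p} {q} w R S = begin
      V (x * (1# + (p * R + q * S))) - (p * R + q * S) * Δ
        -- The hedge term is linear in the return. Moving its sign onto `Δ` lets the solver treat
        -- `- Δ` as one variable.
        ≈⟨ +-cong (V-cong (returns-average (Weights.p+q≈1 w) x R S)) (-‿distribʳ-* _ Δ) ⟩
      V (p * (x * (1# + R)) + q * (x * (1# + S))) + (p * R + q * S) * - Δ
        ≤⟨ +-monoˡ-≤ _ (jensen w _ _) ⟩
      (p * V (x * (1# + R)) + q * V (x * (1# + S))) + (p * R + q * S) * - Δ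
        ≈⟨ solve 7 (λ p q R S A B δ →
             (p :* A :+ q :* B) :+ (p :* R :+ q :* S) :* δ :=
             p :* (A :+ R :* δ) :+ q :* (B :+ S :* δ))
             refl p q R S _ _ (- Δ) ⟩
      p * (V (x * (1# + R)) + R * - Δ) + q * (V (x * (1# + S)) + S * - Δ)
        ≈⟨ +-cong (*-congˡ (+-congˡ (-‿distribʳ-* R Δ))) (*-congˡ (+-congˡ (-‿distribʳ-* S Δ))) ⟨
      p * objective V x Δ R + q * objective V x Δ S ∎
      where open ≤-Reasoning

  -- Monotonicity and uniqueness of continuation values.

  continuation-mono : ∀ {𝒰 V V′ x v v′} → (∀ y → V y ≤ V′ y) →
                      IsContinuationValue 𝒰 V x v → IsContinuationValue 𝒰 V′ x v′ → v ≤ v′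
  continuation-mono {V = V} {V′} {x} {v} {v′} V≤V′
    (m , m-max , _ , v≤m) (m′ , m′-max , (Δ , _ , m′Δ≈v′) , _)
    -- `Δ` is optimal against `V′`, and `R` is the worst return for `V` at this same `Δ`.
    with m-max Δ
  ... | (R , R∈𝒰 , fR≈mΔ) , _ = begin
    v                   ≤⟨ v≤m Δ tt ⟩
    m Δ                 ≈⟨ fR≈mΔ ⟨
    objective V x Δ R   ≤⟨ +-monoˡ-≤ _ (V≤V′ _) ⟩
    objective V′ x Δ R  ≤⟨ proj₂ (m′-max Δ) R R∈𝒰 ⟩
    m′ Δ                ≈⟨ m′Δ≈v′ ⟩
    v′                  ∎
    where open ≤-Reasoning

  -- Continuation values are given by a relation; this makes them functional, and lets two
  -- recursions be compared from pointwise agreement one round later.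
  continuation-unique : ∀ {𝒰 V V′ x v v′} → (∀ y → V y ≈ V′ y) →
                        IsContinuationValue 𝒰 V x v → IsContinuationValue 𝒰 V′ x v′ → v ≈ v′
  continuation-unique V≈V′ cv cv′ = antisym
    (continuation-mono (λ y → ≤-reflexive (V≈V′ y)) cv cv′)
    (continuation-mono (λ y → ≤-reflexive (sym (V≈V′ y))) cv′ cv)

  -- Convex functions on the interval of returns.

  module _ {l u d : Carrier} (l≤0 : l ≤ 0#) (0≤u : 0# ≤ u)
           (0≤d : 0# ≤ d) (width : (u - l) * d ≈ 1#) where

    -- With `d` the reciprocal of the length `u - l`, the weight of each end is the relative
    -- distance of `R` from the opposite end.
    barycentric : ∀ {R} → Interval l u R →
                  ∃[ p ] ∃[ q ] (Weights p q × p * l + q * u ≈ R)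
    barycentric {R} (l≤R , R≤u) = (u - R) * d , (R - l) * d , record
      { 0≤p   = *-nonneg (x≤y⇒0≤y-x R≤u) 0≤d
      ; 0≤q   = *-nonneg (x≤y⇒0≤y-x l≤R) 0≤d
      ; p+q≈1 = sum
      } , combination
      where
      open ≈-Reasoning
      sum : (u - R) * d + (R - l) * d ≈ 1#
      sum = begin
        (u - R) * d + (R - l) * d      ≈⟨ solve 5 (λ u d R R⁻ l⁻ →
            (u :+ R⁻) :* d :+ (R :+ l⁻) :* d := (u :+ l⁻) :* d :+ d :* (R :+ R⁻))
            refl u d R (- R) (- l) ⟩
        (u - l) * d + d * (R - R)      ≈⟨ cancel _ d R ⟩
        (u - l) * d                    ≈⟨ width ⟩
        1#                             ∎
      combination : (u - R) * d * l + (R - l) * d * u ≈ R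
      combination = begin
        (u - R) * d * l + (R - l) * d * u
          -- The inserted zero supplies `R * d * - l` for the main term and `R * d * l` to offset
          -- the part of the first product containing `- R`.
          ≈⟨ cancel _ (R * d) l ⟨
        (u - R) * d * l + (R - l) * d * u + R * d * (l - l)
          ≈⟨ solve 6 (λ u d R l R⁻ l⁻ →
               (u :+ R⁻) :* d :* l :+ (R :+ l⁻) :* d :* u :+ R :* d :* (l :+ l⁻) :=
               R :* ((u :+ l⁻) :* d) :+ u :* d :* (l :+ l⁻) :+ l :* d :* (R :+ R⁻))
               refl u d R l (- R) (- l) ⟩
        R * ((u - l) * d) + u * d * (l - l) + l * d * (R - R)
          ≈⟨ cancel _ (l * d) R ⟩
        R * ((u - l) * d) + u * d * (l - l)
          ≈⟨ cancel _ (u * d) l ⟩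
        R * ((u - l) * d)
          ≈⟨ *-congˡ width ⟩
        R * 1#
          ≈⟨ *-identityʳ R ⟩
        R ∎

    -- A point of the interval is an average of the ends, so its value is at most an average of the
    -- end values, hence at most the larger one.
    max-at-endpoints : ∀ {f} → Congruent _≈_ _≈_ f → Jensen f →
                       IsMax (Interval l u) f (max (f l) (f u))
    max-at-endpoints {f} f-cong jensen = attained , bound
      where
      l≤u : l ≤ u
      l≤u = ≤-trans l≤0 0≤u
      attained : ∃[ R ] (Interval l u R × f R ≈ max (f l) (f u))
      attained with ⊔-sel (f l) (f u)
      ... | inj₁ eq = l , (≤-refl , l≤u) , sym eq
      ... | inj₂ eq = u , (l≤u , ≤-refl) , sym eq
      bound : ∀ R → Interval l u R → f R ≤ max (f l) (f u)
      bound R R∈ with barycentric R∈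
      ... | p , q , w , eq = begin
        f R                ≈⟨ f-cong eq ⟨
        f (p * l + q * u)  ≤⟨ jensen w l u ⟩
        p * f l + q * f u  ≤⟨ average≤max w (f l) (f u) ⟩
        max (f l) (f u)    ∎
        where open ≤-Reasoning

    -- Solving the linear equation gives `Δ = (B - A) / (u - l)`, the hedge ratio of the two-point
    -- model. It is written as `- δ` so that both sides become sums.
    equaliser : ∀ A B → ∃[ Δ ] (A - l * Δ ≈ B - u * Δ)
    equaliser A B = - δ , (begin
      A - l * - δ                   ≈⟨ minus-minus A l ⟩
      A + l * δ                     ≈⟨ cancel _ 1# B ⟨
      A + l * δ + 1# * (B - B)      ≈⟨ solve 5 (λ A B B⁻ l δ →
          A :+ l :* δ :+ con 1 :* (B :+ B⁻) := B :+ l :* δ :+ (A :+ B⁻) :* con 1)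
          refl A B (- B) l δ ⟩
      B + l * δ + (A - B) * 1#      ≈⟨ +-congˡ (*-congˡ width) ⟨
      B + l * δ + (A - B) * ((u - l) * d) ≈⟨ solve 7 (λ A B B⁻ l l⁻ u d →
          B :+ l :* ((A :+ B⁻) :* d) :+ (A :+ B⁻) :* ((u :+ l⁻) :* d) :=
          B :+ u :* ((A :+ B⁻) :* d) :+ ((A :+ B⁻) :* d) :* (l :+ l⁻))
          refl A B (- B) l (- l) u d ⟩
      B + u * δ + δ * (l - l)       ≈⟨ cancel _ δ l ⟩
      B + u * δ                     ≈⟨ minus-minus B u ⟨
      B - u * - δ                   ∎)
      where
      open ≈-Reasoning
      δ : Carrier
      δ = (A - B) * d
      minus-minus : ∀ C R → C - R * - δ ≈ C + R * δ
      minus-minus C R = +-congˡ (trans (-‿distribʳ-* R (- δ)) (*-congˡ (-‿involutive δ)))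

    -- The one-step operator for weights with mean return zero.

    module _ {p q : Carrier} (w : Weights p q) (pl+qu≈0 : p * l + q * u ≈ 0#) where
      open Weights w using (p+q≈1)

      -- The hedge contributes `Δ` times the mean return, which is zero under these weights.
      average-tilt : ∀ A B Δ → p * (A - l * Δ) + q * (B - u * Δ) ≈ p * A + q * B
      average-tilt A B Δ = begin
        p * (A - l * Δ) + q * (B - u * Δ)
          ≈⟨ +-cong (*-congˡ (+-congˡ (-‿distribʳ-* l Δ))) (*-congˡ (+-congˡ (-‿distribʳ-* u Δ))) ⟩
        p * (A + l * - Δ) + q * (B + u * - Δ)
          ≈⟨ solve 7 (λ p q l u A B δ →
               p :* (A :+ l :* δ) :+ q :* (B :+ u :* δ) :=
               p :* A :+ q :* B :+ (p :* l :+ q :* u) :* δ) refl p q l u A B (- Δ) ⟩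
        p * A + q * B + (p * l + q * u) * - Δ
          ≈⟨ +-congˡ (trans (*-congʳ pl+qu≈0) (zeroˡ (- Δ))) ⟩
        p * A + q * B + 0#
          ≈⟨ +-identityʳ _ ⟩
        p * A + q * B ∎
        where open ≈-Reasoning

      -- This is one-step pricing in the binomial model with returns `l` and `u`; `p` and `q` are
      -- its risk-neutral probabilities.
      step : (Carrier → Carrier) → Carrier → Carrier
      step V x = p * V (x * (1# + l)) + q * V (x * (1# + u))

      step-cong : ∀ {V} → Congruent _≈_ _≈_ V → Congruent _≈_ _≈_ (step V)
      step-cong V-cong x≈y =
        +-cong (*-congˡ (V-cong (*-congʳ x≈y))) (*-congˡ (V-cong (*-congʳ x≈y)))

      -- Each summand is `V` after a fixed scaling of the price, so convexity survives the
      -- averaging.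
      step-Jensen : ∀ {V} → Congruent _≈_ _≈_ V → Jensen V → Jensen (step V)
      step-Jensen {V} V-cong jensen {s} {t} w′ x y = begin
        p * V ((s * x + t * y) * (1# + l)) + q * V ((s * x + t * y) * (1# + u))
          ≤⟨ average-mono w (rescale (1# + l)) (rescale (1# + u)) ⟩
        p * (s * V (x * (1# + l)) + t * V (y * (1# + l))) +
        q * (s * V (x * (1# + u)) + t * V (y * (1# + u)))
          ≈⟨ solve 8 (λ p q s t A B C D →
               p :* (s :* A :+ t :* B) :+ q :* (s :* C :+ t :* D) :=
               s :* (p :* A :+ q :* C) :+ t :* (p :* B :+ q :* D)) refl p q s t _ _ _ _ ⟩
        s * step V x + t * step V y ∎
        where
        open ≤-Reasoning
        rescale : ∀ k → V ((s * x + t * y) * k) ≤ s * V (x * k) + t * V (y * k)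
        rescale k = ≤-respˡ-≈
          (V-cong (solve 5 (λ s t x y k →
             s :* (x :* k) :+ t :* (y :* k) := (s :* x :+ t :* y) :* k) refl s t x y k))
          (jensen w′ (x * k) (y * k))

      -- As the mean return is zero, `x` is the average of the two next prices, and Jensen's
      -- inequality for `g` applies there.
      step-above : ∀ {g V} → Congruent _≈_ _≈_ g → Jensen g →
                   (∀ x → g x ≤ V x) → ∀ x → g x ≤ step V x
      step-above {g} {V} g-cong jensen g≤V x = begin
        g x                                              ≈⟨ g-cong (*-identityʳ x) ⟨
        g (x * 1#)                                       ≈⟨ g-cong (*-congˡ (+-identityʳ 1#)) ⟨
        g (x * (1# + 0#))                                ≈⟨ g-cong (*-congˡ (+-congˡ pl+qu≈0)) ⟨
        g (x * (1# + (p * l + q * u)))                   ≈⟨ g-cong (returns-average p+q≈1 x l u) ⟩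
        g (p * (x * (1# + l)) + q * (x * (1# + u)))      ≤⟨ jensen w _ _ ⟩
        p * g (x * (1# + l)) + q * g (x * (1# + u))      ≤⟨ average-mono w (g≤V _) (g≤V _) ⟩
        step V x                                         ∎
        where open ≤-Reasoning

      step-continuation : ∀ {V} → Congruent _≈_ _≈_ V → Jensen V →
                          ∀ x → IsContinuationValue (Interval l u) V x (step V x)
      step-continuation {V} V-cong jensen x =
        m , (λ Δ → max-at-endpoints (objective-cong V-cong x Δ) (objective-Jensen V-cong jensen x Δ)) ,
        -- For every `Δ` the larger end value dominates the average, which is independent of `Δ`. At
        -- the equalising `Δ` the two coincide.
        attained , λ Δ _ → ≤-respˡ-≈ (average-tilt _ _ Δ) (average≤max w _ _)
        where
        m : Carrier → Carrier
        m Δ = max (objective V x Δ l) (objective V x Δ u)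
        attained : ∃[ Δ ] (_ × m Δ ≈ step V x)
        attained with equaliser (V (x * (1# + l))) (V (x * (1# + u)))
        ... | Δ , fl≈fu = Δ , tt , (begin
          max fl fu         ≈⟨ ⊔-cong refl fl≈fu ⟨
          max fl fl         ≈⟨ ⊔-idem fl ⟩
          fl                ≈⟨ average-const p+q≈1 fl ⟨
          p * fl + q * fl   ≈⟨ +-congˡ (*-congˡ fl≈fu) ⟩
          p * fl + q * fu   ≈⟨ average-tilt _ _ Δ ⟩
          step V x          ∎)
          where
          open ≈-Reasoning
          fl fu : Carrier
          fl = objective V x Δ l
          fu = objective V x Δ u

      -- Backward induction over the rounds.

      module _ {g : Carrier → Carrier} (g-cong : Congruent _≈_ _≈_ g) (g-Jensen : Jensen g) where

        -- The argument k is the number of rounds left.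
        value : ℕ → Carrier → Carrier
        value zero    = g
        value (suc k) = step (value k)

        value-cong : ∀ k → Congruent _≈_ _≈_ (value k)
        value-cong zero    = g-cong
        value-cong (suc k) = step-cong (value-cong k)

        value-Jensen : ∀ k → Jensen (value k)
        value-Jensen zero    = g-Jensen
        value-Jensen (suc k) = step-Jensen (value-cong k) (value-Jensen k)

        payoff≤value : ∀ k x → g x ≤ value k x
        payoff≤value zero    x = ≤-refl
        payoff≤value (suc k) x = step-above g-cong g-Jensen (payoff≤value k) x

        value-continuation : ∀ k x → IsContinuationValue (Interval l u) (value k) x (value (suc k) x)
        value-continuation k = step-continuation (value-cong k) (value-Jensen k)

        value-isEuropean : ∀ τ → IsEuropeanValue (Interval l u) τ g (λ t → value (τ ∸ t))
        value-isEuropean τ = terminal , recursion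
          where
          terminal : ∀ x → value (τ ∸ τ) x ≈ g x
          terminal x rewrite n∸n≡0 τ = refl
          recursion : ∀ t → t <ᴺ τ → ∀ x →
                      IsContinuationValue (Interval l u) (value (τ ∸ suc t)) x (value (τ ∸ t) x)
          -- `suc τ ∸ suc t` computes to `τ ∸ t`, so the rewrite exposes the `suc` on which `value`
          -- unfolds.
          recursion t t<τ x rewrite +-∸-assoc 1 t<τ = value-continuation (τ ∸ suc t) x

        european⇒american : ∀ {τ E} → (∀ t x → g x ≤ E t x) →
                            IsEuropeanValue (Interval l u) τ g E → IsAmericanValue (Interval l u) τ g E
        european⇒american g≤E (terminal , recursion) =
          terminal , λ t t<τ x → _ , recursion t t<τ x , sym (x≤y⇒y⊔x≈y (g≤E t x))

        -- Induction on the rounds left. Tying `k` to `t` by a sum lets `refl` replace `τ` by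
        -- `k +ᴺ t`, from which the bound on `t` in the recursion is immediate.
        european≈value : ∀ {τ E} → IsEuropeanValue (Interval l u) τ g E →
                         ∀ k t → k +ᴺ t ≡.≡ τ → ∀ x → E t x ≈ value k x
        european≈value (terminal , _) zero t ≡.refl x = terminal x
        european≈value isE@(_ , recursion) (suc k) t ≡.refl x =
          continuation-unique (european≈value isE k (suc t) (+-suc k t))
            (recursion t (m<n+m t z<s) x) (value-continuation k x)

        -- As in the European case, except that the maximum must also be resolved: once `v` is
        -- identified, it dominates the payoff.
        american≈value : ∀ {τ A} → IsAmericanValue (Interval l u) τ g A →
                         ∀ k t → k +ᴺ t ≡.≡ τ → ∀ x → A t x ≈ value k x
        american≈value (terminal , _) zero t ≡.refl x = terminal x
        american≈value {A = A} isA@(_ , recursion) (suc k) t ≡.refl x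
          with recursion t (m<n+m t z<s) x
        ... | v , cv , At≈max = begin
          A t x                          ≈⟨ At≈max ⟩
          max v (g x)                    ≈⟨ ⊔-cong v≈value refl ⟩
          max (value (suc k) x) (g x)    ≈⟨ x≤y⇒y⊔x≈y (payoff≤value (suc k) x) ⟩
          value (suc k) x                ∎
          where
          open ≈-Reasoning
          v≈value : v ≈ value (suc k) x
          v≈value = continuation-unique (american≈value isA k (suc t) (+-suc k t))
                      cv (value-continuation k x)

        -- Minima and maxima are relations that include attainment, so existence of both value
        -- functions is asserted as well; this keeps the comparison from being vacuous.
        exercise-at-maturity : ∀ {τ} →
          let 𝒰 = Interval l u in
          (∃[ E ] IsEuropeanValue 𝒰 τ g E) ×
          (∃[ A ] IsAmericanValue 𝒰 τ g A) ×
          (∀ E A → IsEuropeanValue 𝒰 τ g E → IsAmericanValue 𝒰 τ g A →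
             (∀ x → A 0 x ≈ E 0 x) ×
             (∀ t → t <ᴺ τ → ∀ x v → IsContinuationValue 𝒰 (A (suc t)) x v → g x ≤ v))
        exercise-at-maturity {τ} =
          (_ , value-isEuropean τ) ,
          (_ , european⇒american (λ t → payoff≤value (τ ∸ t)) (value-isEuropean τ)) ,
          λ E A isE isA →
            (λ x → trans (american≈value isA τ 0 (+-identityʳᴺ τ) x)
                         (sym (european≈value isE τ 0 (+-identityʳᴺ τ) x))) ,
            -- From date `suc t` there remain `τ ∸ suc t` rounds, so `v` is the value with one round
            -- more, which lies above the payoff.
            λ t t<τ x v cv → ≤-respʳ-≈
              (sym (continuation-unique (american≈value isA (τ ∸ suc t) (suc t) (m∸n+n≡m t<τ))
                     cv (value-continuation (τ ∸ suc t) x)))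
              (payoff≤value (suc (τ ∸ suc t)) x)

lemma5p2 :
  {c ℓ₁ ℓ₂ : Level} (ℝ : RealNumbers c ℓ₁ ℓ₂) →
  let open RealNumbers ℝ
      open HedgingGame ℝ
  in
  (τ : ℕ) → 1 ≤ᴺ τ →
  (S₀ : Carrier) → 0# < S₀ →
  (ζ₋ ζ₊ : Carrier) → 0# < ζ₋ → 0# < ζ₊ →
  (g : Carrier → Carrier) → Congruent _≈_ _≈_ g → Convex g →
  let 𝒰 = Interval (- ζ₋) ζ₊ in
  (∃[ E ] IsEuropeanValue 𝒰 τ g E) ×
  (∃[ A ] IsAmericanValue 𝒰 τ g A) ×
  (∀ E A → IsEuropeanValue 𝒰 τ g E → IsAmericanValue 𝒰 τ g A →
     A 0 S₀ ≈ E 0 S₀ ×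
     (∀ t → t <ᴺ τ → ∀ x v →
        IsContinuationValue 𝒰 (A (suc t)) x v → g x ≤ v))
lemma5p2 ℝ τ _ S₀ _ ζ₋ ζ₊ (0≤ζ₋ , 0≉ζ₋) (0≤ζ₊ , _) g g-cong convex =
  let d , width = inverse (ζ₊ - l) width≉0
      0≤d = inverse-nonneg ℝ 0≤width width
      -- The risk-neutral weights are the barycentric coordinates of the return 0.
      _ , _ , w , pl+qu≈0 = barycentric ℝ l≤0 0≤ζ₊ 0≤d width (l≤0 , 0≤ζ₊)
      european , american , agree =
        exercise-at-maturity ℝ l≤0 0≤ζ₊ 0≤d width w pl+qu≈0 g-cong (convex⇒Jensen ℝ g-cong convex)
  in european , american , λ E A isE isA →
       let A≈E , g≤v = agree E A isE isA in A≈E S₀ , g≤v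
  where
  open RealNumbers ℝ
  open TotalOrder totalOrder using (antisym; ≤-respʳ-≈) renaming (trans to ≤-trans)
  l : Carrier
  l = - ζ₋
  l≤0 : l ≤ 0#
  l≤0 = 0≤⇒-≤0 ℝ 0≤ζ₋
  0≤width : 0# ≤ ζ₊ - l
  0≤width = x≤y⇒0≤y-x ℝ (≤-trans l≤0 0≤ζ₊)
  -- A width of zero would force `ζ₋` to be zero as well, so the reciprocal `d` exists.
  ζ₋≤width : ζ₋ ≤ ζ₊ - l
  ζ₋≤width = begin
    ζ₋          ≈⟨ +-identityˡ ζ₋ ⟨
    0# + ζ₋     ≤⟨ +-monoˡ-≤ ζ₋ 0≤ζ₊ ⟩
    ζ₊ + ζ₋     ≈⟨ +-congˡ (-‿involutive ζ₋) ⟨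
    ζ₊ - l      ∎
    where
    open RingProperties ring using (-‿involutive)
    open PartialOrderReasoning (TotalOrder.poset totalOrder)
  width≉0 : ¬ (ζ₊ - l ≈ 0#)
  width≉0 width≈0 = 0≉ζ₋ (antisym 0≤ζ₋ (≤-respʳ-≈ width≈0 ζ₋≤width))
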